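{- For every odd integer $k\ge 3$, the flower snark $F_k$ satisfies $\tau(F_k)=4$.
   Context: For odd $k\ge 3$, the flower snark $F_k$ is the cubic graph on the $4k$ vertices $x_0,\ldots,x_{k-1}$, $y_0,\ldots,y_{k-1}$, $z_0,\ldots,z_{k-1}$, $t_0,\ldots,t_{k-1}$ such that $x_0x_1\cdots x_{k-1}$ is an induced cycle of length $k$, $y_0y_1\cdots y_{k-1}z_0z_1\cdots z_{k-1}$ is an induced cycle of length $2k$, and for each $i=0,\ldots,k-1$ the vertex $t_i$ is adjacent to $x_i$, $y_i$ and $z_i$. For a bridgeless cubic graph $G$, the perfect matching index $\tau(G)$ is the minimum number of perfect matchings of $G$ whose union is $E(G)$. -}

module Defs where

open import Data.Nat using (ℕ; zero; suc; _≡ᵇ_)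
open import Data.Nat.DivMod using (_mod_)
open import Data.Fin using (Fin; toℕ; zero)
open import Data.Bool using (Bool; true; false; if_then_else_)
open import Data.Product using (Σ; ∃; _×_; _,_; proj₁; proj₂)
open import Data.Sum using (_⊎_)
open import Relation.Binary.PropositionalEquality using (_≡_)
open import Relation.Nullary using (¬_)

record Graph : Set₁ where
  field
    V    : Set
    E    : Set
    ends : E → V × V

open Graph public

Incident : (G : Graph) → E G → V G → Set
Incident G e v = proj₁ (ends G e) ≡ v ⊎ proj₂ (ends G e) ≡ v

IsPerfectMatching : (G : Graph) → (E G → Bool) → Set
IsPerfectMatching G M =
  (v : V G) → Σ (E G) λ e → (M e ≡ true × Incident G e v) ×
     ((e' : E G) → M e' ≡ true → Incident G e' v → e' ≡ e)

PMCover : (G : Graph) → ℕ → Set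
PMCover G j =
  Σ (Fin j → E G → Bool) λ Ms →
    ((i : Fin j) → IsPerfectMatching G (Ms i)) ×
    ((e : E G) → ∃ λ i → Ms i e ≡ true)

PerfectMatchingIndex≡ : Graph → ℕ → Set
PerfectMatchingIndex≡ G n =
  PMCover G n × ((j : ℕ) → j Data.Nat.< n → ¬ PMCover G j)

next : {k : ℕ} → Fin k → Fin k
next {suc n} i = suc (toℕ i) mod suc n

isLast : {k : ℕ} → Fin k → Bool
isLast {suc n} i = toℕ i ≡ᵇ n

data FV (k : ℕ) : Set where
  x y z t : Fin k → FV k

data FE (k : ℕ) : Set where
  xx yy zz tx ty tz : Fin k → FE k

flowerEnds : {k : ℕ} → FE k → FV k × FV k
flowerEnds (xx i) = x i , x (next i)
-- 2k-cycle y_0 … y_{k-1} z_0 … z_{k-1}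
flowerEnds (yy i) = y i , (if isLast i then z (next i) else y (next i))
flowerEnds (zz i) = z i , (if isLast i then y (next i) else z (next i))
flowerEnds (tx i) = t i , x i
flowerEnds (ty i) = t i , y i
flowerEnds (tz i) = t i , z i

Flower : ℕ → Graph
Flower k = record { V = FV k ; E = FE k ; ends = flowerEnds }

{-# OPTIONS --safe #-}

-- Lower bound: a cover by at most three perfect matchings yields a proper
-- 3-edge-colouring.  Take the colours in ℤ/3, so that the colours at a vertex
-- sum to 0, and let (a , b , d) be the colours of the rim edges xx i, yy i, zz i.
-- Put σ = a + b + d and δ = (a − b)(b − d)(d − a).  The edges at t_i carry three
-- distinct colours, whose sum is 0; so passing a spoke layer negates σ, and it
-- preserves δ.  The twist of the 2k-cycle fixes σ and negates δ.  Going around an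
-- odd number of layers with one twist thus gives σ = −σ and δ = −δ, i.e. σ = δ = 0,
-- which happens only for a = b = d, and such a triple cannot be extended.
--
-- Upper bound: label every edge with the set of matchings using it.  The labels
-- must be nonempty and partition the four matchings at each vertex.  There is
-- such a labelling which is 2-periodic except near the layer 0, where it
-- absorbs the twist and the odd length.
module Submission where

open import Defs
open import Data.Bool using (Bool; true; false)
import Data.Bool.Properties as Bool
open import Data.Fin using (Fin; zero; suc; toℕ; fromℕ; inject₁; inject≤)
open import Data.Fin.Induction using (<-weakInduction)
open import Data.Fin.Patterns using (0F; 1F; 2F)
open import Data.Fin.Properties
  using (_≟_; all?; any?; toℕ-injective; toℕ-fromℕ; toℕ-fromℕ<; toℕ-inject₁; toℕ<n; inject≤-injective)
open import Data.Fin.Relation.Unary.Top using (view; ‵fromℕ; ‵inject₁)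
open import Data.Fin.Subset using (Subset)
open import Data.Nat using (ℕ; zero; suc; _≤_; _%_; _+_; _*_; z≤n; s≤s; s≤s⁻¹)
open import Data.Nat.DivMod using (_mod_; n%n≡0; m<n⇒m%n≡m)
open import Data.Nat.Properties using (<⇒≢; ≤-reflexive)
open import Data.Product using (∃; _×_; _,_; proj₁; proj₂)
open import Data.Product.Properties using (≡-dec)
open import Data.Sum using (inj₁; inj₂)
open import Data.Vec using (Vec; []; _∷_; lookup; map)
open import Data.Vec.Properties using (lookup-map)
open import Function using (_∘_; Injective)
open import Relation.Binary.PropositionalEquality
  using (_≡_; _≢_; refl; sym; trans; cong; cong₂; subst; module ≡-Reasoning)
open import Relation.Nullary using (Dec; contradiction)
open import Relation.Nullary.Decidable using (from-yes; ¬?; _×-dec_; _→-dec_; map′)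

private
  variable
    n : ℕ

-- Cyclic order of the layers, and the edges at each vertex

next-fromℕ : ∀ n → next (fromℕ n) ≡ zero
next-fromℕ n = toℕ-injective (begin
  toℕ (suc (toℕ (fromℕ n)) mod suc n)  ≡⟨ toℕ-fromℕ< _ ⟩
  suc (toℕ (fromℕ n)) % suc n          ≡⟨ cong (λ m → suc m % suc n) (toℕ-fromℕ n) ⟩
  suc n % suc n                        ≡⟨ n%n≡0 (suc n) ⟩
  0                                    ∎)
  where open ≡-Reasoning

next-inject₁ : (i : Fin n) → next (inject₁ i) ≡ suc i
next-inject₁ {n} i = toℕ-injective (begin
  toℕ (suc (toℕ (inject₁ i)) mod suc n)  ≡⟨ toℕ-fromℕ< _ ⟩
  suc (toℕ (inject₁ i)) % suc n          ≡⟨ cong (λ m → suc m % suc n) (toℕ-inject₁ i) ⟩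
  suc (toℕ i) % suc n                    ≡⟨ m<n⇒m%n≡m (s≤s (toℕ<n i)) ⟩
  suc (toℕ i)                            ∎)
  where open ≡-Reasoning

isLast-fromℕ : ∀ n → isLast (fromℕ n) ≡ true
isLast-fromℕ zero    = refl
isLast-fromℕ (suc n) = isLast-fromℕ n

isLast-inject₁ : (i : Fin n) → isLast (inject₁ i) ≡ false
isLast-inject₁ zero    = refl
isLast-inject₁ (suc i) = isLast-inject₁ i

prev : Fin (suc n) → Fin (suc n)
prev {n} zero = fromℕ n
prev (suc i)  = inject₁ i

next-prev : (i : Fin (suc n)) → next (prev i) ≡ i
next-prev {n} zero = next-fromℕ n
next-prev (suc i)  = next-inject₁ i

prev-next : (i : Fin (suc n)) → prev (next i) ≡ i
prev-next i with view i
... | ‵fromℕ {n}  = cong prev (next-fromℕ n)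
... | ‵inject₁ j  = cong prev (next-inject₁ j)

-- Fails for a single layer, whose index is its own predecessor; hence the bound of at least two
-- layers.
prev≢ : (i : Fin (suc (suc n))) → prev i ≢ i
prev≢ zero    ()
prev≢ (suc i) eq = <⇒≢ (s≤s (≤-reflexive (toℕ-inject₁ i))) (cong toℕ eq)

-- The 2k-cycle swaps the y- and z-tracks between the layers k − 1 and 0.
y-in z-in : Fin (suc n) → FE (suc n)
y-in {n} zero = zz (fromℕ n)
y-in (suc i)  = yy (inject₁ i)
z-in {n} zero = yy (fromℕ n)
z-in (suc i)  = zz (inject₁ i)

-- At x, y and z the order is: incoming rim edge, outgoing rim edge, spoke.
star : FV (suc n) → Vec (FE (suc n)) 3
star (x i) = xx (prev i) ∷ xx i ∷ tx i ∷ []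
star (y i) = y-in i ∷ yy i ∷ ty i ∷ []
star (z i) = z-in i ∷ zz i ∷ tz i ∷ []
star (t i) = tx i ∷ ty i ∷ tz i ∷ []

y-in-end : (i : Fin (suc n)) → proj₂ (flowerEnds (y-in i)) ≡ y i
y-in-end {n} zero rewrite isLast-fromℕ n   = cong y (next-fromℕ n)
y-in-end (suc i)  rewrite isLast-inject₁ i = cong y (next-inject₁ i)

z-in-end : (i : Fin (suc n)) → proj₂ (flowerEnds (z-in i)) ≡ z i
z-in-end {n} zero rewrite isLast-fromℕ n   = cong z (next-fromℕ n)
z-in-end (suc i)  rewrite isLast-inject₁ i = cong z (next-inject₁ i)

star-incident : (v : FV (suc n)) (j : Fin 3) → Incident (Flower (suc n)) (lookup (star v) j) v
star-incident (x i) 0F = inj₂ (cong x (next-prev i))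
star-incident (x i) 1F = inj₁ refl
star-incident (x i) 2F = inj₂ refl
star-incident (y i) 0F = inj₂ (y-in-end i)
star-incident (y i) 1F = inj₁ refl
star-incident (y i) 2F = inj₂ refl
star-incident (z i) 0F = inj₂ (z-in-end i)
star-incident (z i) 1F = inj₁ refl
star-incident (z i) 2F = inj₂ refl
star-incident (t i) 0F = inj₁ refl
star-incident (t i) 1F = inj₁ refl
star-incident (t i) 2F = inj₁ refl

head-in-star : (e : FE (suc n)) → ∃ λ j → lookup (star (proj₂ (flowerEnds e))) j ≡ e
head-in-star (xx i) = 0F , cong xx (prev-next i)
-- The last y-edge crosses to the z-track, where it is `z-in zero`; the view separates it from the
-- others.
head-in-star (yy i) with view i
... | ‵fromℕ {n} rewrite isLast-fromℕ n   | next-fromℕ n   = 0F , refl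
... | ‵inject₁ j rewrite isLast-inject₁ j | next-inject₁ j = 0F , refl
head-in-star (zz i) with view i
... | ‵fromℕ {n} rewrite isLast-fromℕ n   | next-fromℕ n   = 0F , refl
... | ‵inject₁ j rewrite isLast-inject₁ j | next-inject₁ j = 0F , refl
head-in-star (tx i) = 2F , refl
head-in-star (ty i) = 2F , refl
head-in-star (tz i) = 2F , refl

tail-in-star : (e : FE (suc n)) → ∃ λ j → lookup (star (proj₁ (flowerEnds e))) j ≡ e
tail-in-star (xx i) = 1F , refl
tail-in-star (yy i) = 1F , refl
tail-in-star (zz i) = 1F , refl
tail-in-star (tx i) = 0F , refl
tail-in-star (ty i) = 1F , refl
tail-in-star (tz i) = 2F , refl

-- Together with `star-incident`, this makes `star v` a complete list of the edges at `v`, so that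
-- incidence can be replaced by three positions.
incident⇒star : {v : FV (suc n)} (e : FE (suc n)) → Incident (Flower (suc n)) e v →
                ∃ λ j → lookup (star v) j ≡ e
incident⇒star e (inj₁ refl) = tail-in-star e
incident⇒star e (inj₂ refl) = head-in-star e

lookup₃-injective : {A : Set} {a b c : A} → a ≢ b → a ≢ c → b ≢ c →
                    Injective _≡_ _≡_ (lookup (a ∷ b ∷ c ∷ []))
lookup₃-injective a≢b a≢c b≢c {0F} {0F} eq = refl
lookup₃-injective a≢b a≢c b≢c {0F} {1F} eq = contradiction eq a≢b
lookup₃-injective a≢b a≢c b≢c {0F} {2F} eq = contradiction eq a≢c
lookup₃-injective a≢b a≢c b≢c {1F} {0F} eq = contradiction (sym eq) a≢b
lookup₃-injective a≢b a≢c b≢c {1F} {1F} eq = refl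
lookup₃-injective a≢b a≢c b≢c {1F} {2F} eq = contradiction eq b≢c
lookup₃-injective a≢b a≢c b≢c {2F} {0F} eq = contradiction (sym eq) a≢c
lookup₃-injective a≢b a≢c b≢c {2F} {1F} eq = contradiction (sym eq) b≢c
lookup₃-injective a≢b a≢c b≢c {2F} {2F} eq = refl

star-injective : (v : FV (suc (suc n))) → Injective _≡_ _≡_ (lookup (star v))
star-injective (x i)       = lookup₃-injective (prev≢ i ∘ xx-injective) (λ ()) (λ ())
  where
  xx-injective : ∀ {k} {i j : Fin k} → xx i ≡ xx j → i ≡ j
  xx-injective refl = refl
-- At layer 0 the incoming edge belongs to the other track, so the constructors already differ.
star-injective (y zero)    = lookup₃-injective (λ ()) (λ ()) (λ ())
star-injective (y (suc i)) = lookup₃-injective (prev≢ (suc i) ∘ yy-injective) (λ ()) (λ ())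
  where
  yy-injective : ∀ {k} {i j : Fin k} → yy i ≡ yy j → i ≡ j
  yy-injective refl = refl
star-injective (z zero)    = lookup₃-injective (λ ()) (λ ()) (λ ())
star-injective (z (suc i)) = lookup₃-injective (prev≢ (suc i) ∘ zz-injective) (λ ()) (λ ())
  where
  zz-injective : ∀ {k} {i j : Fin k} → zz i ≡ zz j → i ≡ j
  zz-injective refl = refl
star-injective (t i)       = lookup₃-injective (λ ()) (λ ()) (λ ())

-- The lower bound

infixl 6 _⊕_ _⊖_
infixl 7 _⊗_

_⊕_ _⊖_ _⊗_ : Fin 3 → Fin 3 → Fin 3
a ⊕ b = (toℕ a + toℕ b) mod 3
a ⊗ b = (toℕ a * toℕ b) mod 3

-- Doubling is negation in ℤ/3.
neg : Fin 3 → Fin 3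
neg a = a ⊕ a

a ⊖ b = a ⊕ neg b

-- The three colours sum to 0, so for distinct `a` and `b` this is the remaining one.
third : Fin 3 → Fin 3 → Fin 3
third a b = neg (a ⊕ b)

Invariant : Set
Invariant = Fin 3 × Fin 3

invariant : Fin 3 → Fin 3 → Fin 3 → Invariant
invariant a b d = a ⊕ b ⊕ d , (a ⊖ b) ⊗ (b ⊖ d) ⊗ (d ⊖ a)

negσ negδ : Invariant → Invariant
negσ (σ , δ) = neg σ , δ
negδ (σ , δ) = σ , neg δ

neg-involutive : ∀ a → neg (neg a) ≡ a
neg-involutive = from-yes (all? λ a → neg (neg a) ≟ a)

negσ-involutive : ∀ w → negσ (negσ w) ≡ w
negσ-involutive (σ , δ) = cong (_, δ) (neg-involutive σ)

neg-fixed : ∀ a → neg a ≡ a → a ≡ 0F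
neg-fixed = from-yes (all? λ a → (neg a ≟ a) →-dec (a ≟ 0F))

_≟ᵢ_ : (v w : Invariant) → Dec (v ≡ w)
_≟ᵢ_ = ≡-dec _≟_ _≟_

invariant-swap : ∀ a b d → invariant a d b ≡ negδ (invariant a b d)
invariant-swap = from-yes (all? λ a → all? λ b → all? λ d →
  invariant a d b ≟ᵢ negδ (invariant a b d))

-- Here `a`, `b`, `d` enter a layer and `p`, `q`, `r` are its spoke colours. If `a`, `b`, `d` are
-- distinct, they form one of the two derangements of (p, q, r); these are exchanged and have the
-- same sign δ. Otherwise δ = 0 before and after. A triple with a = b = d would meet one of the
-- spoke colours. All cases are checked exhaustively.
invariant-third : ∀ a b d p q r → p ≢ q → p ≢ r → q ≢ r → a ≢ p → b ≢ q → d ≢ r →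
  invariant (third a p) (third b q) (third d r) ≡ negσ (invariant a b d) ×
  invariant a b d ≢ (0F , 0F)
invariant-third = from-yes (
  all? λ a → all? λ b → all? λ d → all? λ p → all? λ q → all? λ r →
  ¬? (p ≟ q) →-dec (¬? (p ≟ r) →-dec (¬? (q ≟ r) →-dec
  (¬? (a ≟ p) →-dec (¬? (b ≟ q) →-dec (¬? (d ≟ r) →-dec
  ((invariant (third a p) (third b q) (third d r) ≟ᵢ negσ (invariant a b d)) ×-dec
   ¬? (invariant a b d ≟ᵢ (0F , 0F)))))))))

third-unique : ∀ a b c → a ≢ b → a ≢ c → b ≢ c → b ≡ third a c
third-unique = from-yes (all? λ a → all? λ b → all? λ c →
  ¬? (a ≟ b) →-dec (¬? (a ≟ c) →-dec (¬? (b ≟ c) →-dec (b ≟ third a c))))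

-- Transport of the invariant around the layers

ProperColouring : ∀ {n} → (FE (suc n) → Fin 3) → Set
ProperColouring {n} c = (v : FV (suc n)) → Injective _≡_ _≡_ (c ∘ lookup (star v))

module Colouring (c : FE (suc n) → Fin 3) (proper : ProperColouring c) where

  distinct : ∀ v {i j} → i ≢ j → c (lookup (star v) i) ≢ c (lookup (star v) j)
  distinct v i≢j eq = i≢j (proper v eq)

  out-colour : ∀ v → c (lookup (star v) 1F) ≡ third (c (lookup (star v) 0F)) (c (lookup (star v) 2F))
  out-colour v = third-unique _ _ _ (distinct v λ ()) (distinct v λ ()) (distinct v λ ())

  -- `before (suc i)` reduces to `rim (inject₁ i)`; only `before zero` sees the twist.
  rim before : Fin (suc n) → Invariant
  rim i    = invariant (c (xx i)) (c (yy i)) (c (zz i))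
  before i = invariant (c (xx (prev i))) (c (y-in i)) (c (z-in i))

  step : ∀ i → rim i ≡ negσ (before i) × before i ≢ (0F , 0F)
  step i rewrite out-colour (x i) | out-colour (y i) | out-colour (z i) =
    invariant-third _ _ _ _ _ _
      (distinct (t i) {0F} {1F} λ ()) (distinct (t i) {0F} {2F} λ ()) (distinct (t i) {1F} {2F} λ ())
      (distinct (x i) {0F} {2F} λ ()) (distinct (y i) {0F} {2F} λ ()) (distinct (z i) {0F} {2F} λ ())

  negσ^ : ℕ → Invariant → Invariant
  negσ^ zero    w = w
  negσ^ (suc m) w = negσ (negσ^ m w)

  -- An odd number m + 1 of layers leaves m steps from layer 0 to the last layer, and these cancel
  -- in pairs.
  negσ^-even : ∀ m → suc m % 2 ≡ 1 → ∀ w → negσ^ m w ≡ w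
  negσ^-even zero          _   w = refl
  negσ^-even (suc (suc m)) odd w = trans (negσ-involutive _) (negσ^-even m odd w)

  rim-iterate : ∀ i → rim i ≡ negσ^ (toℕ i) (rim zero)
  rim-iterate = <-weakInduction _ refl λ i ih →
    trans (proj₁ (step (suc i)))
          (cong negσ (trans ih (cong (λ m → negσ^ m (rim zero)) (toℕ-inject₁ i))))

  even-length : suc n % 2 ≢ 1
  even-length odd = proj₂ (step zero) (trans before-zero (cong₂ _,_ σ≡0 (cong neg δ≡0)))
    where
    rim-last : rim (fromℕ n) ≡ rim zero
    rim-last = trans (rim-iterate (fromℕ n))
      (trans (cong (λ m → negσ^ m (rim zero)) (toℕ-fromℕ n)) (negσ^-even n odd (rim zero)))

    before-zero : before zero ≡ negδ (rim zero)
    -- `y-in zero` is a z-edge and `z-in zero` a y-edge, so the last two colours are exchanged.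
    before-zero = trans (invariant-swap (c (xx (fromℕ n))) (c (yy (fromℕ n))) (c (zz (fromℕ n))))
                        (cong negδ rim-last)

    antipodal : rim zero ≡ negσ (negδ (rim zero))
    antipodal = trans (proj₁ (step zero)) (cong negσ before-zero)

    σ≡0 : proj₁ (rim zero) ≡ 0F
    σ≡0 = neg-fixed _ (sym (cong proj₁ antipodal))

    δ≡0 : proj₂ (rim zero) ≡ 0F
    δ≡0 = neg-fixed _ (sym (cong proj₂ antipodal))

-- Colour each edge by one chosen matching that contains it: two edges at a vertex with the same
-- colour lie in one matching, hence coincide.
cover⇒colouring : ∀ {j} → j ≤ 3 → PMCover (Flower (suc (suc n))) j →
                  ∃ λ (c : FE (suc (suc n)) → Fin 3) → ProperColouring c
cover⇒colouring {n} j≤3 (Ms , perfect , covered) = (λ e → inject≤ (colour e) j≤3) ,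
  λ v eq → star-injective v
    (colour-proper (star-incident v _) (star-incident v _) (inject≤-injective _ _ _ _ eq))
  where
  colour = λ e → proj₁ (covered e)

  colour-proper : ∀ {e e′ v} → Incident (Flower (suc (suc n))) e v →
                  Incident (Flower (suc (suc n))) e′ v → colour e ≡ colour e′ → e ≡ e′
  colour-proper {e} {e′} {v} e∼v e′∼v eq with perfect (colour e) v
  ... | _ , _ , unique =
    trans (unique e (proj₂ (covered e)) e∼v)
          (sym (unique e′ (subst (λ i → Ms i e′ ≡ true) (sym eq) (proj₂ (covered e′))) e′∼v))

-- The upper bound

-- Quantified over matchings first: the i-th condition is perfect matching number i at one vertex,
-- with edges replaced by star positions.
Partition : Vec (Subset 4) 3 → Set
Partition ls = ∀ i → ∃ λ j → lookup (lookup ls j) i ≡ true ×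
                             (∀ j′ → lookup (lookup ls j′) i ≡ true → j′ ≡ j)

partition? : ∀ ls → Dec (Partition ls)
partition? ls = all? λ i → any? λ j → (lookup (lookup ls j) i Bool.≟ true) ×-dec
                  all? λ j′ → (lookup (lookup ls j′) i Bool.≟ true) →-dec (j′ ≟ j)

labelling⇒cover : (label : FE (suc n) → Subset 4) →
                  (∀ e → ∃ λ i → lookup (label e) i ≡ true) →
                  (∀ v → Partition (map label (star v))) →
                  PMCover (Flower (suc n)) 4
labelling⇒cover {n} label nonempty partition = Ms , perfect , nonempty
  where
  Ms : Fin 4 → FE (suc n) → Bool
  Ms i e = lookup (label e) i

  lookup-label : ∀ v j → lookup (map label (star v)) j ≡ label (lookup (star v) j)
  lookup-label v j = lookup-map j label (star v)

  perfect : ∀ i → IsPerfectMatching (Flower (suc n)) (Ms i)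
  perfect i v with partition v i
  ... | j , true-at , unique =
    lookup (star v) j ,
    (trans (cong (λ l → lookup l i) (sym (lookup-label v j))) true-at , star-incident v j) ,
    only
    where
    only : ∀ e → Ms i e ≡ true → Incident (Flower (suc n)) e v → e ≡ lookup (star v) j
    only e e∈M e∼v with incident⇒star e e∼v
    ... | j′ , refl = cong (lookup (star v))
      (unique j′ (trans (cong (λ l → lookup l i) (lookup-label v j′)) e∈M))

-- The phase of a layer: 0, 1, then alternately even (2, 4, …) and odd (3, 5, …).
data Phase : Set where
  first second even odd : Phase

phase : ℕ → Phase
phase 0                         = first
phase 1                         = second
phase 2                         = even
phase 3                         = odd
phase (suc (suc (suc (suc m)))) = phase (suc (suc m))

-- Only passages from a layer to its successor without wrapping; the passage from the last layer to
-- layer 0 is treated separately.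
data _↝_ : Phase → Phase → Set where
  first↝second : first ↝ second
  second↝even  : second ↝ even
  even↝odd     : even ↝ odd
  odd↝even     : odd ↝ even

phase-step : ∀ m → phase m ↝ phase (suc m)
phase-step 0                         = first↝second
phase-step 1                         = second↝even
phase-step 2                         = even↝odd
phase-step 3                         = odd↝even
phase-step (suc (suc (suc (suc m)))) = phase-step (suc (suc m))

-- The last index is even and at least 2, so the seam always joins `even` to `first`.
phase-last : ∀ n → suc n % 2 ≡ 1 → 3 ≤ suc n → phase n ≡ even
phase-last 2                         _   _ = refl
phase-last (suc (suc (suc (suc m)))) k-odd _ = phase-last (suc (suc m)) k-odd (s≤s (s≤s (s≤s z≤n)))
phase-last 0 _ (s≤s ())

-- In the tables, position i says whether the i-th matching uses the edge.
pattern ● = true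
pattern ○ = false

x-rim y-rim z-rim x-spoke y-spoke z-spoke : Phase → Subset 4

x-rim first  = ● ∷ ○ ∷ ○ ∷ ○ ∷ []
x-rim even   = ○ ∷ ○ ∷ ● ∷ ○ ∷ []
-- In all rim tables the last row serves both `second` and `odd`: beyond layer 0, only the x- and
-- z-spokes of layer 1 break the periodic pattern.
x-rim _      = ○ ∷ ○ ∷ ○ ∷ ● ∷ []

y-rim first  = ○ ∷ ● ∷ ○ ∷ ○ ∷ []
y-rim even   = ○ ∷ ● ∷ ○ ∷ ○ ∷ []
y-rim _      = ● ∷ ○ ∷ ● ∷ ○ ∷ []

z-rim first  = ○ ∷ ○ ∷ ● ∷ ● ∷ []
z-rim even   = ● ∷ ○ ∷ ○ ∷ ● ∷ []
z-rim _      = ○ ∷ ● ∷ ○ ∷ ○ ∷ []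

x-spoke first  = ○ ∷ ● ∷ ○ ∷ ● ∷ []
x-spoke second = ○ ∷ ● ∷ ● ∷ ○ ∷ []
x-spoke _      = ● ∷ ● ∷ ○ ∷ ○ ∷ []

y-spoke first  = ○ ∷ ○ ∷ ● ∷ ○ ∷ []
y-spoke _      = ○ ∷ ○ ∷ ○ ∷ ● ∷ []

z-spoke first  = ● ∷ ○ ∷ ○ ∷ ○ ∷ []
z-spoke second = ● ∷ ○ ∷ ○ ∷ ○ ∷ []
z-spoke _      = ○ ∷ ○ ∷ ● ∷ ○ ∷ []

label : FE (suc n) → Subset 4
label (xx i) = x-rim (phase (toℕ i))
label (yy i) = y-rim (phase (toℕ i))
label (zz i) = z-rim (phase (toℕ i))
label (tx i) = x-spoke (phase (toℕ i))
label (ty i) = y-spoke (phase (toℕ i))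
label (tz i) = z-spoke (phase (toℕ i))

all-phases? : {P : Phase → Set} → (∀ p → Dec (P p)) → Dec (∀ p → P p)
all-phases? P? = map′
  (λ { (p₁ , p₂ , p₃ , p₄) → λ { first → p₁ ; second → p₂ ; even → p₃ ; odd → p₄ } })
  (λ f → f first , f second , f even , f odd)
  (P? first ×-dec P? second ×-dec P? even ×-dec P? odd)

nonempty? : (l : Subset 4) → Dec (∃ λ i → lookup l i ≡ true)
nonempty? l = any? λ i → lookup l i Bool.≟ true

label-nonempty : (e : FE (suc n)) → ∃ λ i → lookup (label e) i ≡ true
label-nonempty (xx i) = from-yes (all-phases? (nonempty? ∘ x-rim)) (phase (toℕ i))
label-nonempty (yy i) = from-yes (all-phases? (nonempty? ∘ y-rim)) (phase (toℕ i))
label-nonempty (zz i) = from-yes (all-phases? (nonempty? ∘ z-rim)) (phase (toℕ i))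
label-nonempty (tx i) = from-yes (all-phases? (nonempty? ∘ x-spoke)) (phase (toℕ i))
label-nonempty (ty i) = from-yes (all-phases? (nonempty? ∘ y-spoke)) (phase (toℕ i))
label-nonempty (tz i) = from-yes (all-phases? (nonempty? ∘ z-spoke)) (phase (toℕ i))

all-steps? : {P : Phase → Phase → Set} → (∀ p q → Dec (P p q)) → Dec (∀ {p q} → p ↝ q → P p q)
all-steps? P? = map′
  (λ { (p₁ , p₂ , p₃ , p₄) → λ { first↝second → p₁ ; second↝even → p₂ ; even↝odd → p₃ ; odd↝even → p₄ } })
  (λ f → f first↝second , f second↝even , f even↝odd , f odd↝even)
  (P? first second ×-dec P? second even ×-dec P? even odd ×-dec P? odd even)

x-partition : ∀ {p q} → p ↝ q → Partition (x-rim p ∷ x-rim q ∷ x-spoke q ∷ [])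
x-partition = from-yes (all-steps? λ p q → partition? (x-rim p ∷ x-rim q ∷ x-spoke q ∷ []))

y-partition : ∀ {p q} → p ↝ q → Partition (y-rim p ∷ y-rim q ∷ y-spoke q ∷ [])
y-partition = from-yes (all-steps? λ p q → partition? (y-rim p ∷ y-rim q ∷ y-spoke q ∷ []))

z-partition : ∀ {p q} → p ↝ q → Partition (z-rim p ∷ z-rim q ∷ z-spoke q ∷ [])
z-partition = from-yes (all-steps? λ p q → partition? (z-rim p ∷ z-rim q ∷ z-spoke q ∷ []))

t-partition : ∀ p → Partition (x-spoke p ∷ y-spoke p ∷ z-spoke p ∷ [])
t-partition = from-yes (all-phases? λ p → partition? (x-spoke p ∷ y-spoke p ∷ z-spoke p ∷ []))

phase-inject₁ : (i : Fin n) → phase (toℕ (inject₁ i)) ↝ phase (suc (toℕ i))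
phase-inject₁ i rewrite toℕ-inject₁ i = phase-step (toℕ i)

label-partition : phase n ≡ even → (v : FV (suc n)) → Partition (map label (star v))
label-partition {n} last≡even (x zero) rewrite toℕ-fromℕ n | last≡even =
  from-yes (partition? (x-rim even ∷ x-rim first ∷ x-spoke first ∷ []))
label-partition {n} last≡even (y zero) rewrite toℕ-fromℕ n | last≡even =
  -- The twist: the y-track of layer 0 is entered from the z-rim of the last layer.
  from-yes (partition? (z-rim even ∷ y-rim first ∷ y-spoke first ∷ []))
label-partition {n} last≡even (z zero) rewrite toℕ-fromℕ n | last≡even =
  from-yes (partition? (y-rim even ∷ z-rim first ∷ z-spoke first ∷ []))
label-partition _ (x (suc i)) = x-partition (phase-inject₁ i)
label-partition _ (y (suc i)) = y-partition (phase-inject₁ i)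
label-partition _ (z (suc i)) = z-partition (phase-inject₁ i)
label-partition _ (t i)       = t-partition (phase (toℕ i))

theorem3p8 : (k : ℕ) → k % 2 ≡ 1 → 3 ≤ k → PerfectMatchingIndex≡ (Flower k) 4
theorem3p8 (suc (suc m)) k-odd 3≤k =
  labelling⇒cover label label-nonempty (label-partition (phase-last (suc m) k-odd 3≤k)) ,
  λ j j<4 cover → let c , proper = cover⇒colouring (s≤s⁻¹ j<4) cover
                  in Colouring.even-length c proper k-odd
theorem3p8 1 _ (s≤s ())
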